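{- Let $q\equiv 3 \pmod{4}$ be a prime power. Then $$\mathcal{K}_3(G_2(q)) = \frac{q(q-1)(q-3)}{2^3}.$$
   Context: $G_2(q)$ is the Paley tournament of order $q$: the digraph with vertex set the finite field $\mathbb{F}_q$ where $a \to b$ is an edge if and only if $b-a$ is a nonzero square in $\mathbb{F}_q$. For a digraph $G$, $\mathcal{K}_m(G)$ is the number of transitive subtournaments of order $m$ contained in $G$; a tournament of order $m$ is transitive if its vertices can be listed $a_1,\dots,a_m$ with $a_i \to a_j$ for all $i<j$. -}

module Defs where

open import Algebra.Apartness.Bundles using (HeytingField)
open import Data.Fin.Base using (Fin)
open import Data.Fin.Properties using (_≟_; all?; any?)
open import Data.Fin.Subset using (Subset; inside; outside; _∈_; ∣_∣)
open import Data.Fin.Subset.Properties using (_∈?_)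
open import Data.List.Base as List using (List; cartesianProductWith; filter; length)
import Data.List.Membership.Propositional as ListMembership
open import Data.List.Membership.Propositional.Properties
  using (∈-cartesianProductWith⁺; ∈-allFin)
open import Data.List.Relation.Unary.Any as ListAny using (here)
open import Data.Nat.Base using (ℕ; zero; suc; _^_; _≤_)
import Data.Nat.Properties as ℕ
open import Data.Nat.Primality using (Prime)
open import Data.Product.Base using (_×_; _,_; ∃-syntax)
open import Data.Sum.Base using (_⊎_)
open import Data.Vec.Base using (Vec; []; _∷_; lookup)
import Data.Vec.Membership.Propositional as VecMembership
import Data.Vec.Membership.DecPropositional as DecVecMembership
open import Data.Vec.Relation.Unary.AllPairs using (AllPairs; allPairs?)
open import Data.Vec.Relation.Unary.Unique.Propositional using (Unique)
open import Function.Bundles using (Inverse)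
open import Level using (Level; _⊔_) renaming (suc to lsuc)
open import Relation.Binary.Bundles using (Setoid)
open import Relation.Binary.Core using (Rel)
open import Relation.Binary.Definitions using (Decidable; _Respects₂_)
open import Relation.Binary.PropositionalEquality as ≡ using (_≡_; _≢_)
open import Relation.Nullary using (¬_; Dec)
open import Relation.Nullary.Decidable using (map′; ¬?; _×-dec_; _⊎-dec_; _→-dec_)

private
  variable
    a c ℓ ℓ₁ ℓ₂ e : Level

IsPrimePower : ℕ → Set
IsPrimePower q = ∃[ p ] ∃[ k ] (Prime p × 1 ≤ k × q ≡ p ^ k)

Enumeration : Setoid c ℓ → ℕ → Set (c ⊔ ℓ)
Enumeration S n = Inverse S (≡.setoid (Fin n))

record FiniteDigraph (c ℓ e : Level) : Set (lsuc (c ⊔ ℓ ⊔ e)) where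
  infix 4 _⟶_ _⟶?_
  field
    vertices    : Setoid c ℓ
    order       : ℕ
    enumeration : Enumeration vertices order

  open Setoid vertices renaming (Carrier to Vertex) public
  open Inverse enumeration using () renaming (from to vertex) public

  field
    _⟶_    : Rel Vertex e
    _⟶?_   : Decidable _⟶_
    ⟶-resp : _⟶_ Respects₂ _≈_

-- A candidate subdigraph of a digraph of order n, its vertices being named by
-- their positions in the enumeration: there is an arc from u to v when v
-- belongs to the u-th entry of `arcs`.
record Subdigraph (n : ℕ) : Set where
  constructor mkSubdigraph
  field
    verts : Subset n
    arcs  : Vec (Subset n) n

open Subdigraph public

module _ {n : ℕ} where

  Arc : Subdigraph n → Fin n → Fin n → Set
  Arc H u v = v ∈ lookup (arcs H) u

  arc? : ∀ H → Decidable (Arc H)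
  arc? H u v = v ∈? lookup (arcs H) u

  IsTournament : Subdigraph n → Set
  IsTournament H =
    (∀ u → ¬ Arc H u u) ×
    (∀ u v → u ∈ verts H → v ∈ verts H → u ≢ v →
      (Arc H u v × ¬ Arc H v u) ⊎ (Arc H v u × ¬ Arc H u v))

  isTournament? : ∀ H → Dec (IsTournament H)
  isTournament? H =
    all? (λ u → ¬? (arc? H u u)) ×-dec
    all? (λ u → all? λ v →
      (u ∈? verts H) →-dec ((v ∈? verts H) →-dec (¬? (u ≟ v) →-dec
        ((arc? H u v ×-dec ¬? (arc? H v u)) ⊎-dec
         (arc? H v u ×-dec ¬? (arc? H u v))))))

  Lists : ∀ {m} → Vec (Fin n) m → Subset n → Set
  Lists as V = Unique as ×
    (∀ v → (v ∈ V → v VecMembership.∈ as) × (v VecMembership.∈ as → v ∈ V))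

  lists? : ∀ {m} (as : Vec (Fin n) m) V → Dec (Lists as V)
  lists? as V =
    allPairs? (λ u v → ¬? (u ≟ v)) as ×-dec
    all? (λ v → ((v ∈? V) →-dec (v ∈ᵥ? as)) ×-dec ((v ∈ᵥ? as) →-dec (v ∈? V)))
    where open DecVecMembership (_≟_ {n}) using () renaming (_∈?_ to _∈ᵥ?_)

vectors : {A : Set a} → List A → ∀ n → List (Vec A n)
vectors xs zero    = [] List.∷ List.[]
vectors xs (suc n) = cartesianProductWith _∷_ xs (vectors xs n)

∈-vectors : {A : Set a} {xs : List A} → (∀ x → x ListMembership.∈ xs) →
            ∀ {n} (as : Vec A n) → as ListMembership.∈ vectors xs n
∈-vectors complete []       = here ≡.refl
∈-vectors complete (x ∷ as) =
  ∈-cartesianProductWith⁺ _∷_ (complete x) (∈-vectors complete as)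

subsets : ∀ n → List (Subset n)
subsets = vectors (inside List.∷ outside List.∷ List.[])

subdigraphs : ∀ n → List (Subdigraph n)
subdigraphs n = cartesianProductWith mkSubdigraph (subsets n) (vectors (subsets n) n)

module _ {n : ℕ} (m : ℕ) where

  -- AllPairs R (a₁ ∷ … ∷ aₘ ∷ []) says that R aᵢ aⱼ for all i < j.
  HasTransitiveListing : Subdigraph n → Set
  HasTransitiveListing H =
    ∃[ as ] (Lists {m = m} as (verts H) × AllPairs (Arc H) as)

  hasTransitiveListing? : ∀ H → Dec (HasTransitiveListing H)
  hasTransitiveListing? H =
    map′ ListAny.satisfied
         (λ (as , p) → ListMembership.lose (∈-vectors ∈-allFin as) p)
         (ListAny.any? (λ as → lists? as (verts H) ×-dec allPairs? (arc? H) as)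
                       (vectors (List.allFin n) m))

  IsTransitiveTournament : Subdigraph n → Set
  IsTransitiveTournament H =
    ∣ verts H ∣ ≡ m × IsTournament H × HasTransitiveListing H

  isTransitiveTournament? : ∀ H → Dec (IsTransitiveTournament H)
  isTransitiveTournament? H =
    (∣ verts H ∣ ℕ.≟ m) ×-dec isTournament? H ×-dec hasTransitiveListing? H

module _ (G : FiniteDigraph c ℓ e) where
  open FiniteDigraph G

  ContainedIn : Subdigraph order → Set e
  ContainedIn H = ∀ u v → Arc H u v →
    u ∈ verts H × v ∈ verts H × (vertex u ⟶ vertex v)

  containedIn? : ∀ H → Dec (ContainedIn H)
  containedIn? H = all? λ u → all? λ v → arc? H u v →-dec
    ((u ∈? verts H) ×-dec (v ∈? verts H) ×-dec (vertex u ⟶? vertex v))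

-- Subtournaments need not be induced: they are counted as pairs of a vertex
-- set and an arc set. The two readings agree when G has no 2-cycles or loops.
𝒦 : ℕ → FiniteDigraph c ℓ e → ℕ
𝒦 m G = length (filter (λ H → containedIn? G H ×-dec isTransitiveTournament? m H)
                       (subdigraphs (FiniteDigraph.order G)))

-- HeytingField is the library's notion of field. For a finite carrier
-- invertibility can be decided by search, so x # y coincides with x ≉ y and
-- this is the usual notion of a finite field.
module _ (F : HeytingField c ℓ₁ ℓ₂) {q : ℕ}
         (enum : Enumeration (HeytingField.setoid F) q) where
  open HeytingField F
  open Inverse enum

  infix 4 _≈?_
  _≈?_ : Decidable _≈_
  x ≈? y = map′
    (λ eq → trans (sym (inverseʳ ≡.refl)) (inverseʳ eq))
    to-cong
    (to x ≟ to y)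

  IsNonzeroSquare : Carrier → Set (c ⊔ ℓ₁)
  IsNonzeroSquare x = ¬ (x ≈ 0#) × ∃[ y ] x ≈ y * y

  isNonzeroSquare? : ∀ x → Dec (IsNonzeroSquare x)
  isNonzeroSquare? x = ¬? (x ≈? 0#) ×-dec map′
    (λ (i , eq) → from i , eq)
    (λ (y , eq) → to y , trans eq (sym (*-cong (inverseʳ ≡.refl) (inverseʳ ≡.refl))))
    (any? (λ i → x ≈? from i * from i))

  isNonzeroSquare-resp : ∀ {x y} → x ≈ y → IsNonzeroSquare x → IsNonzeroSquare y
  isNonzeroSquare-resp x≈y (x≉0 , z , x≈zz) =
    (λ y≈0 → x≉0 (trans x≈y y≈0)) , z , trans (sym x≈y) x≈zz

  G₂ : FiniteDigraph c ℓ₁ (c ⊔ ℓ₁)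
  G₂ = record
    { vertices    = setoid
    ; order       = q
    ; enumeration = enum
    ; _⟶_         = λ a b → IsNonzeroSquare (b - a)
    ; _⟶?_        = λ a b → isNonzeroSquare? (b - a)
    ; ⟶-resp      =
        (λ b≈b′ → isNonzeroSquare-resp (+-cong b≈b′ refl)) ,
        (λ a≈a′ → isNonzeroSquare-resp (+-cong refl (-‿cong a≈a′)))
    }

{-# OPTIONS --safe #-}
module Submission where

-- For q ≡ 3 (mod 4) the Paley digraph of order q is a regular tournament, and
-- the number of transitive triples of a tournament is determined by its
-- outdegrees.
--
-- In a digraph without loops and 2-cycles, a contained tournament is the
-- subdigraph induced on its vertex set, and its transitive listing is unique.
-- Hence 𝒦 m counts the chains a₁, …, aₘ with an arc from aᵢ to aⱼ for all i < j
-- (𝒦≡#chains). For m = 3 let t be the number of chains starting at a vertex u of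
-- outdegree d in a tournament. An ordered pair (v , w) of out-neighbours of u has
-- an arc from v to w, an arc from w to v, or v = w, and exactly one of these, so
-- t + t + d = d² (chainsFrom-outdegree).
--
-- It remains to see that the Paley digraph is a tournament with all outdegrees
-- (q - 1) / 2. As q is odd, 1 + 1 ≠ 0, so each nonzero square has exactly two
-- square roots, and there are k = (q - 1) / 2 nonzero squares (#squares≡k). This
-- number is also the outdegree of every vertex, by translation. As q ≡ 3 (mod 4),
-- k is odd. Were - 1 a square, negation would act on the nonzero squares without
-- fixed points and k would be even; so - 1 is not a square (-1∉S), and a nonzero
-- square never has a square as its negative (S-antisym). The k nonzero squares
-- and their k negatives are thus disjoint and exhaust the q - 1 nonzero elements
-- (S-or-neg), which is the tournament property.
--
-- With k = 1 + 2j this gives t = kj, and summing over the q vertices yields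
-- qkj = q(q - 1)(q - 3)/8.

open import Defs
open import Algebra.Apartness.Bundles using (HeytingField; HeytingCommutativeRing)
import Algebra.Apartness.Properties.HeytingCommutativeRing as HeytingProperties
open import Algebra.Bundles using (CommutativeRing)
import Algebra.Properties.CommutativeSemigroup as CommutativeSemigroupProperties
import Algebra.Properties.Ring as RingProperties
open import Data.Bool.Base using (true; false; if_then_else_)
open import Data.Fin.Base as Fin using (Fin; zero; suc)
import Data.Fin.Properties as Fin
open import Data.Fin.Permutation using (permutation)
open import Data.Fin.Subset using (Subset; inside; outside; _∈_; _∉_; ∣_∣; ⁅_⁆; _∪_; ⊥)
open import Data.Fin.Subset.Properties
  using (_∈?_; ∉⊥; ∣⊥∣≡0; x∈⁅x⁆; x∈⁅y⁆⇒x≡y; x∈p∪q⁺; x∈p∪q⁻; ∪-identityˡ; ⊆-antisym)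
open import Data.List.Base as List using (List; filter; length; cartesianProductWith)
import Data.List.Membership.Propositional as ListMembership
open import Data.List.Membership.Propositional.Properties
  using (∈-cartesianProductWith⁺; ∈-allFin; ∈-filter⁺; ∈-filter⁻; ∈-map⁺; ∈-map⁻)
open import Data.List.Membership.Propositional.Properties.WithK using (unique∧set⇒bag)
open import Data.List.Properties using (length-map; filter-++; length-++)
open import Data.List.Relation.Binary.BagAndSetEquality using (∼bag⇒↭)
open import Data.List.Relation.Binary.Permutation.Propositional.Properties using (↭-length)
import Data.List.Relation.Unary.All as ListAll
import Data.List.Relation.Unary.All.Properties as ListAll
import Data.List.Relation.Unary.AllPairs as ListAllPairs
import Data.List.Relation.Unary.Any as ListAny
import Data.List.Relation.Unary.Unique.Propositional as ListUnique
import Data.List.Relation.Unary.Unique.Propositional.Properties as ListUnique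
open import Data.Nat.Base as ℕ using (ℕ; zero; suc; _≤_; z≤n; _%_; _^_)
open import Data.Nat.DivMod using (m≡m%n+[m/n]*n)
import Data.Nat.Properties as ℕ
open import Data.Nat.Tactic.RingSolver using (solve-∀)
open import Data.Product.Base using (_×_; _,_; proj₁; proj₂; ∃-syntax)
open import Data.Sum.Base using (_⊎_; inj₁; inj₂)
open import Data.Unit.Base using (tt)
open import Data.Vec.Base using (Vec; []; _∷_; tabulate; here; there)
open import Data.Vec.Membership.Propositional using () renaming (_∈_ to _∈ᵥ_)
open import Data.Vec.Properties
  using (∷-injective; []=⇒lookup; lookup⇒[]=; lookup∘tabulate; tabulate∘lookup; tabulate-cong)
open import Data.Vec.Relation.Unary.All as All using (All; []; _∷_)
open import Data.Vec.Relation.Unary.AllPairs as AllPairs using (AllPairs; []; _∷_; allPairs?)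
open import Data.Vec.Relation.Unary.Any using (here; there)
open import Data.Vec.Relation.Unary.Unique.Propositional using (Unique)
open import Function.Base using (_∘_; id)
open import Function.Bundles using (Inverse; mk⇔)
open import Level using (Level)
open import Relation.Binary.Bundles using (Setoid)
open import Relation.Binary.Core using (Rel)
open import Relation.Binary.Definitions using (Asymmetric; Decidable; tri<; tri≈; tri>)
open import Relation.Binary.PropositionalEquality as ≡
  using (_≡_; _≢_; cong; cong₂; subst; module ≡-Reasoning)
import Relation.Binary.Reasoning.Setoid as SetoidReasoning
open import Relation.Nullary using (¬_; Dec; yes; no; does; contradiction)
open import Relation.Nullary.Decidable using (_×-dec_; ¬?; dec-true)
open import Relation.Unary as Unary using (Pred)

open import Algebra.Properties.Semiring.Sum ℕ.+-*-semiring

private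
  variable
    a b c ℓ ℓ₁ ℓ₂ e p : Level
    A : Set a
    B : Set b
    m n : ℕ

-- Transitive subtournaments as chains

module _ where
  open ≡ using (refl; sym; trans)

  unique-map⁺ : {P : Pred A p} {f : A → B} →
    (∀ {x y} → P x → P y → f x ≡ f y → x ≡ y) →
    ∀ {xs} → ListAll.All P xs → ListUnique.Unique xs → ListUnique.Unique (List.map f xs)
  unique-map⁺ inj ListAll.[] ListAllPairs.[] = ListAllPairs.[]
  unique-map⁺ inj (px ListAll.∷ pxs) (x∉xs ListAllPairs.∷ xs!) =
    ListAll.map⁺ (ListAll.zipWith (λ (py , x≢y) fx≡fy → x≢y (inj px py fx≡fy)) (pxs , x∉xs))
    ListAllPairs.∷ unique-map⁺ inj pxs xs!

  length-unique : {xs ys : List A} → ListUnique.Unique xs → ListUnique.Unique ys →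
    (∀ {z} → z ListMembership.∈ xs → z ListMembership.∈ ys) →
    (∀ {z} → z ListMembership.∈ ys → z ListMembership.∈ xs) →
    length xs ≡ length ys
  length-unique xs! ys! xs⊆ys ys⊆xs =
    ↭-length (∼bag⇒↭ (unique∧set⇒bag xs! ys! (mk⇔ xs⊆ys ys⊆xs)))

  vectors-unique : {xs : List A} → ListUnique.Unique xs → ∀ n → ListUnique.Unique (vectors xs n)
  vectors-unique xs! zero    = ListAll.[] ListAllPairs.∷ ListAllPairs.[]
  vectors-unique xs! (suc n) =
    ListUnique.cartesianProductWith⁺ _∷_ ∷-injective xs! (vectors-unique xs! n)

  subsets-unique : ∀ n → ListUnique.Unique (subsets n)
  subsets-unique = vectors-unique
    (((λ ()) ListAll.∷ ListAll.[]) ListAllPairs.∷ ListAll.[] ListAllPairs.∷ ListAllPairs.[])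

  ∈-subsets : (V : Subset n) → V ListMembership.∈ subsets n
  ∈-subsets = ∈-vectors λ where
    inside  → ListAny.here refl
    outside → ListAny.there (ListAny.here refl)

  subdigraphs-unique : ∀ n → ListUnique.Unique (subdigraphs n)
  subdigraphs-unique n = ListUnique.cartesianProductWith⁺ mkSubdigraph
    (λ { refl → refl , refl }) (subsets-unique n) (vectors-unique (subsets-unique n) n)

  ∈-subdigraphs : (H : Subdigraph n) → H ListMembership.∈ subdigraphs n
  ∈-subdigraphs (mkSubdigraph V As) =
    ∈-cartesianProductWith⁺ mkSubdigraph (∈-subsets V) (∈-vectors ∈-subsets As)

  all-∈ : {P : Pred A p} {as : Vec A m} → (∀ {v} → v ∈ᵥ as → P v) → All P as
  all-∈ {as = []}     f = []
  all-∈ {as = a ∷ as} f = f (here refl) ∷ all-∈ (f ∘ there)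

  module _ {R : Rel A ℓ} where

    allPairs-compare : {as : Vec A m} → AllPairs R as →
      ∀ {u v} → u ∈ᵥ as → v ∈ᵥ as → u ≢ v → R u v ⊎ R v u
    allPairs-compare (_ ∷ _)   (here refl)  (here refl)  u≢v = contradiction refl u≢v
    allPairs-compare (r ∷ _)   (here refl)  (there v∈as) u≢v = inj₁ (All.lookup r v∈as)
    allPairs-compare (r ∷ _)   (there u∈as) (here refl)  u≢v = inj₂ (All.lookup r u∈as)
    allPairs-compare (_ ∷ rs)  (there u∈as) (there v∈as) u≢v = allPairs-compare rs u∈as v∈as u≢v

    allPairs-map-on : {P : Pred A p} {S : Rel A ℓ₁} → (∀ {u v} → P u → P v → R u v → S u v) →
      {as : Vec A m} → All P as → AllPairs R as → AllPairs S as
    allPairs-map-on f []         []       = []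
    allPairs-map-on f (pa ∷ pas) (r ∷ rs) =
      All.map (λ (pv , av) → f pa pv av) (All.zip (pas , r)) ∷ allPairs-map-on f pas rs

    -- A vector increasing for an asymmetric relation is determined by the set
    -- of its entries: the head is the only entry below all the others.
    allPairs-unique : Asymmetric R → {as bs : Vec A m} → AllPairs R as → AllPairs R bs →
      (∀ {v} → v ∈ᵥ as → v ∈ᵥ bs) → (∀ {v} → v ∈ᵥ bs → v ∈ᵥ as) → as ≡ bs
    allPairs-unique asym [] [] _ _ = refl
    allPairs-unique asym {x ∷ as} {y ∷ bs} (x<as ∷ as↑) (y<bs ∷ bs↑) as⊆bs bs⊆as =
      cong₂ _∷_ x≡y (allPairs-unique asym as↑ bs↑
        (λ v∈as → tail-∈ (λ { refl → irrefl (All.lookup x<as (subst (_∈ᵥ as) (sym x≡y) v∈as)) })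
                         (as⊆bs (there v∈as)))
        (λ v∈bs → tail-∈ (λ { refl → irrefl (All.lookup y<bs (subst (_∈ᵥ bs) x≡y v∈bs)) })
                         (bs⊆as (there v∈bs))))
      where
      irrefl : ∀ {v} → ¬ R v v
      irrefl r = asym r r

      tail-∈ : ∀ {k w v} {cs : Vec A k} → v ≢ w → v ∈ᵥ (w ∷ cs) → v ∈ᵥ cs
      tail-∈ v≢w (here v≡w)   = contradiction v≡w v≢w
      tail-∈ v≢w (there v∈cs) = v∈cs

      heads : x ∈ᵥ (y ∷ bs) → y ∈ᵥ (x ∷ as) → x ≡ y
      heads (here x≡y)   _            = x≡y
      heads (there _)    (here y≡x)   = sym y≡x
      heads (there x∈bs) (there y∈as) =
        contradiction (All.lookup x<as y∈as) (asym (All.lookup y<bs x∈bs))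

      x≡y : x ≡ y
      x≡y = heads (as⊆bs (here refl)) (bs⊆as (here refl))

  -- The set of entries of a vector.
  entries : Vec (Fin n) m → Subset n
  entries []       = ⊥
  entries (a ∷ as) = ⁅ a ⁆ ∪ entries as

  ∈-entries⁺ : ∀ {v : Fin n} (as : Vec (Fin n) m) → v ∈ᵥ as → v ∈ entries as
  ∈-entries⁺ (a ∷ as) (here refl)  = x∈p∪q⁺ (inj₁ (x∈⁅x⁆ a))
  ∈-entries⁺ (a ∷ as) (there v∈as) = x∈p∪q⁺ (inj₂ (∈-entries⁺ as v∈as))

  ∈-entries⁻ : ∀ {v : Fin n} (as : Vec (Fin n) m) → v ∈ entries as → v ∈ᵥ as
  ∈-entries⁻ []       v∈⊥ = contradiction v∈⊥ ∉⊥
  ∈-entries⁻ (a ∷ as) v∈  with x∈p∪q⁻ ⁅ a ⁆ (entries as) v∈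
  ... | inj₁ v∈a  = here (x∈⁅y⁆⇒x≡y a v∈a)
  ... | inj₂ v∈as = there (∈-entries⁻ as v∈as)

  ∣⁅x⁆∪p∣ : ∀ (x : Fin n) {V} → x ∉ V → ∣ ⁅ x ⁆ ∪ V ∣ ≡ suc ∣ V ∣
  ∣⁅x⁆∪p∣ zero    {inside ∷ V}  x∉V = contradiction here x∉V
  ∣⁅x⁆∪p∣ zero    {outside ∷ V} x∉V = cong (suc ∘ ∣_∣) (∪-identityˡ V)
  ∣⁅x⁆∪p∣ (suc x) {inside ∷ V}  x∉V = cong suc (∣⁅x⁆∪p∣ x (x∉V ∘ there))
  ∣⁅x⁆∪p∣ (suc x) {outside ∷ V} x∉V = ∣⁅x⁆∪p∣ x (x∉V ∘ there)

  ∣entries∣ : (as : Vec (Fin n) m) → Unique as → ∣ entries as ∣ ≡ m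
  ∣entries∣ {n} []  _ = ∣⊥∣≡0 n
  ∣entries∣ (a ∷ as) (a∉as ∷ as!) = trans
    (∣⁅x⁆∪p∣ a (λ a∈ → All.lookup a∉as (∈-entries⁻ as a∈) refl))
    (cong suc (∣entries∣ as as!))

  module _ {P : Pred (Fin n) p} (P? : Unary.Decidable P) where

    -- The set of the elements of Fin n satisfying a decidable predicate.
    comprehension : Subset n
    comprehension = tabulate (does ∘ P?)

    ∈-comprehension⁺ : ∀ {v} → P v → v ∈ comprehension
    ∈-comprehension⁺ {v} pv =
      lookup⇒[]= v _ (trans (lookup∘tabulate _ v) (dec-true (P? v) pv))

    ∈-comprehension⁻ : ∀ {v} → v ∈ comprehension → P v
    ∈-comprehension⁻ {v} v∈ = help (P? v) (trans (sym (lookup∘tabulate _ v)) ([]=⇒lookup v∈))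
      where
      help : (d : Dec (P v)) → does d ≡ true → P v
      help (yes pv) _ = pv

  module _ (G : FiniteDigraph c ℓ e) where
    open FiniteDigraph G using (order; vertex; _⟶_; _⟶?_)

    -- The arcs of G between vertices named by their positions.
    infix 4 _⇒_ _⇒?_
    _⇒_ : Rel (Fin order) e
    u ⇒ v = vertex u ⟶ vertex v

    _⇒?_ : Decidable _⇒_
    u ⇒? v = vertex u ⟶? vertex v

    private
      InducedArc? : ∀ (V : Subset order) u v → Dec (u ∈ V × v ∈ V × u ⇒ v)
      InducedArc? V u v = (u ∈? V) ×-dec (v ∈? V) ×-dec (u ⇒? v)

    -- The subdigraph induced on a set of vertices.
    induced : Subset order → Subdigraph order
    induced V = mkSubdigraph V (tabulate λ u → comprehension (InducedArc? V u))

    inducedArc⁺ : ∀ {V u v} → u ∈ V → v ∈ V → u ⇒ v → Arc (induced V) u v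
    inducedArc⁺ {V} {u} {v} u∈V v∈V u⇒v =
      subst (v ∈_) (sym (lookup∘tabulate _ u)) (∈-comprehension⁺ (InducedArc? V u) (u∈V , v∈V , u⇒v))

    inducedArc⁻ : ∀ {V u v} → Arc (induced V) u v → u ∈ V × v ∈ V × u ⇒ v
    inducedArc⁻ {V} {u} {v} uv =
      ∈-comprehension⁻ (InducedArc? V u) (subst (v ∈_) (lookup∘tabulate _ u) uv)

    module _ (asym : Asymmetric _⇒_) where

      -- A tournament H contained in G has every arc of G between its vertices:
      -- otherwise H, and so G, would have the reversed arc.
      contained-tournament-induced : ∀ {H} → ContainedIn G H → IsTournament H → H ≡ induced (verts H)
      contained-tournament-induced {H@(mkSubdigraph V As)} H⊆G (_ , total) =
        cong (mkSubdigraph V) (trans (sym (tabulate∘lookup As)) (tabulate-cong λ u →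
          ⊆-antisym (∈-comprehension⁺ (InducedArc? V u) ∘ H⊆G u _)
                    (induced⊆H ∘ ∈-comprehension⁻ (InducedArc? V u))))
        where
        induced⊆H : ∀ {u v} → u ∈ V × v ∈ V × u ⇒ v → Arc H u v
        induced⊆H {u} {v} (u∈V , v∈V , u⇒v)
          with total u v u∈V v∈V (λ { refl → asym u⇒v u⇒v })
        ... | inj₁ (uv , _) = uv
        ... | inj₂ (vu , _) = contradiction (proj₂ (proj₂ (H⊆G v u vu))) (asym u⇒v)

      module _ (m : ℕ) where

        private
          -- A listing a₁ , … , aₘ with aᵢ ⇒ aⱼ for all i < j.
          Chain : Vec (Fin order) m → Set _
          Chain = AllPairs _⇒_

          -- The subdigraphs counted by 𝒦 m G.
          Counted : Subdigraph order → Set _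
          Counted H = ContainedIn G H × IsTransitiveTournament m H

        chain⇒counted : ∀ {as} → Chain as → Counted (induced (entries as))
        chain⇒counted {as} as↑ =
          (λ u v → inducedArc⁻) ,
          ∣entries∣ as as! ,
          ((λ u uu → irrefl (inducedArc⁻ uu)) , total) ,
          as ,
          (as! , λ v → ∈-entries⁻ as , ∈-entries⁺ as) ,
          allPairs-map-on inducedArc⁺ (all-∈ (∈-entries⁺ as)) as↑
          where
          irrefl : ∀ {u} → u ∈ entries as × u ∈ entries as × u ⇒ u → _
          irrefl (_ , _ , u⇒u) = asym u⇒u u⇒u

          as! : Unique as
          as! = AllPairs.map (λ { u⇒v refl → asym u⇒v u⇒v }) as↑

          total : ∀ u v → u ∈ entries as → v ∈ entries as → u ≢ v → _
          total u v u∈ v∈ u≢v with allPairs-compare as↑ (∈-entries⁻ as u∈) (∈-entries⁻ as v∈) u≢v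
          ... | inj₁ u⇒v = inj₁ (inducedArc⁺ u∈ v∈ u⇒v , asym u⇒v ∘ proj₂ ∘ proj₂ ∘ inducedArc⁻)
          ... | inj₂ v⇒u = inj₂ (inducedArc⁺ v∈ u∈ v⇒u , asym v⇒u ∘ proj₂ ∘ proj₂ ∘ inducedArc⁻)

        counted⇒chain : ∀ {H} → Counted H → ∃[ as ] (Chain as × H ≡ induced (entries as))
        counted⇒chain {H} (H⊆G , _ , tournament , as , (_ , lists) , as↑) =
          as ,
          AllPairs.map (proj₂ ∘ proj₂ ∘ H⊆G _ _) as↑ ,
          trans (contained-tournament-induced H⊆G tournament) (cong induced
            (⊆-antisym (λ {v} → ∈-entries⁺ as ∘ proj₁ (lists v))
                       (λ {v} → proj₂ (lists v) ∘ ∈-entries⁻ as)))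

        -- The induced subdigraph remembers the set of entries, and a chain is
        -- determined by its entries.
        chain-injective : ∀ {as bs} → Chain as → Chain bs →
          induced (entries as) ≡ induced (entries bs) → as ≡ bs
        chain-injective {as} {bs} as↑ bs↑ eq = allPairs-unique asym as↑ bs↑
          (∈-entries⁻ bs ∘ subst (_ ∈_) (cong verts eq) ∘ ∈-entries⁺ as)
          (∈-entries⁻ as ∘ subst (_ ∈_) (sym (cong verts eq)) ∘ ∈-entries⁺ bs)

        -- Sending a chain to the subdigraph induced on its entries is a bijection
        -- onto the counted subdigraphs.
        𝒦≡#chains : 𝒦 m G ≡ length (filter (allPairs? _⇒?_) (vectors (List.allFin order) m))
        𝒦≡#chains = trans
          (length-unique
            (ListUnique.filter⁺ _ (subdigraphs-unique order))
            (unique-map⁺ chain-injective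
              (ListAll.all-filter (allPairs? _⇒?_) (vectors (List.allFin order) m))
              (ListUnique.filter⁺ _ (vectors-unique (ListUnique.allFin⁺ order) m)))
            counted-listed listed-counted)
          (length-map (induced ∘ entries) chains)
          where
          chains = filter (allPairs? _⇒?_) (vectors (List.allFin order) m)
          Counted? = λ H → containedIn? G H ×-dec isTransitiveTournament? m H

          counted-listed : ∀ {H} → H ListMembership.∈ filter Counted? (subdigraphs order) →
            H ListMembership.∈ List.map (induced ∘ entries) chains
          counted-listed {H} H∈
            with as , as↑ , refl ← counted⇒chain {H}
              (proj₂ (∈-filter⁻ Counted? {xs = subdigraphs order} H∈)) =
            ∈-map⁺ (induced ∘ entries) (∈-filter⁺ (allPairs? _⇒?_) (∈-vectors ∈-allFin as) as↑)

          listed-counted : ∀ {H} → H ListMembership.∈ List.map (induced ∘ entries) chains →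
            H ListMembership.∈ filter Counted? (subdigraphs order)
          listed-counted H∈ with as , as∈ , refl ← ∈-map⁻ (induced ∘ entries) H∈ =
            ∈-filter⁺ Counted? (∈-subdigraphs _)
              (chain⇒counted (proj₂ (∈-filter⁻ (allPairs? _⇒?_) {xs = vectors (List.allFin order) m} as∈)))

-- Transitive triples of a tournament

module _ where
  open ≡ using (refl; sym; trans)
  open import Data.Nat.Base using (_+_; _*_)

  -- The indicator of a decidable proposition.
  𝟙 : Dec A → ℕ
  𝟙 d = if does d then 1 else 0

  𝟙-true : (d : Dec A) → A → 𝟙 d ≡ 1
  𝟙-true (yes _) _ = refl
  𝟙-true (no ¬a) a = contradiction a ¬a

  𝟙-false : (d : Dec A) → ¬ A → 𝟙 d ≡ 0
  𝟙-false (yes a) ¬a = contradiction a ¬a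
  𝟙-false (no _)  _  = refl

  𝟙-cong : (d : Dec A) (d′ : Dec B) → (A → B) → (B → A) → 𝟙 d ≡ 𝟙 d′
  𝟙-cong (yes a) d′ f g = sym (𝟙-true d′ (f a))
  𝟙-cong (no ¬a) d′ f g = sym (𝟙-false d′ (¬a ∘ g))

  𝟙-¬ : (d : Dec A) → 𝟙 (¬? d) + 𝟙 d ≡ 1
  𝟙-¬ (yes _) = refl
  𝟙-¬ (no _)  = refl

  𝟙-idem : (d : Dec A) → 𝟙 d * 𝟙 d ≡ 𝟙 d
  𝟙-idem (yes _) = refl
  𝟙-idem (no _)  = refl

  -- A termwise inequality between families with equal sums is an equality.
  sum-≤-≡ : (f g : Fin n → ℕ) → (∀ i → f i ≤ g i) → sum f ≡ sum g → ∀ i → f i ≡ g i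
  sum-≤-≡ {suc n} f g f≤g eq = λ where
      zero    → f₀≡g₀
      (suc i) → sum-≤-≡ (f ∘ suc) (g ∘ suc) (f≤g ∘ suc)
        (ℕ.+-cancelˡ-≡ (f zero) _ _ (trans eq (cong (_+ sum (g ∘ suc)) (sym f₀≡g₀)))) i
    where
    sum-mono : ∀ {k} (f g : Fin k → ℕ) → (∀ i → f i ≤ g i) → sum f ≤ sum g
    sum-mono {zero}  f g f≤g = ℕ.≤-reflexive refl
    sum-mono {suc k} f g f≤g = ℕ.+-mono-≤ (f≤g zero) (sum-mono (f ∘ suc) (g ∘ suc) (f≤g ∘ suc))

    f₀≡g₀ : f zero ≡ g zero
    f₀≡g₀ = ℕ.≤-antisym (f≤g zero) (ℕ.+-cancelʳ-≤ (sum (f ∘ suc)) _ _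
      (ℕ.≤-trans (ℕ.+-monoʳ-≤ (g zero) (sum-mono (f ∘ suc) (g ∘ suc) (f≤g ∘ suc))) (ℕ.≤-reflexive (sym eq))))

  sum-delta : (f : Fin n → ℕ) (k : Fin n) → ∑[ i < n ] (f i * 𝟙 (k Fin.≟ i)) ≡ f k
  sum-delta {suc n} f zero = begin
    f zero * 1 + ∑[ i < n ] (f (suc i) * 0) ≡⟨ cong₂ _+_ (ℕ.*-identityʳ (f zero))
                                                 (sum-cong-≗ (ℕ.*-zeroʳ ∘ f ∘ suc)) ⟩
    f zero + sum {n} (λ _ → 0)              ≡⟨ cong (f zero +_) (sum-replicate-zero n) ⟩
    f zero + 0                              ≡⟨ ℕ.+-comm (f zero) 0 ⟩
    f zero                                  ∎
    where open ≡-Reasoning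
  sum-delta {suc n} f (suc k) = trans
    (cong (_+ ∑[ i < n ] (f (suc i) * 𝟙 (k Fin.≟ i))) (ℕ.*-zeroʳ (f zero)))
    (sum-delta (f ∘ suc) k)

  sum-const : ∀ n k → sum {n} (λ _ → k) ≡ n * k
  sum-const zero    k = refl
  sum-const (suc n) k = cong (k +_) (sum-const n k)

  sum-ones : ∀ n → sum {n} (λ _ → 1) ≡ n
  sum-ones n = trans (sum-const n 1) (ℕ.*-identityʳ n)

  #filter-map : {P : Pred B p} (P? : Unary.Decidable P) (f : A → B) (xs : List A) →
    length (filter P? (List.map f xs)) ≡ length (filter (P? ∘ f) xs)
  #filter-map P? f List.[]       = refl
  #filter-map P? f (x List.∷ xs) with does (P? (f x))
  ... | true  = cong suc (#filter-map P? f xs)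
  ... | false = #filter-map P? f xs

  #filter-vectors : {P : Pred (Vec A (suc m)) p} (P? : Unary.Decidable P)
    (f : Fin n → A) (xs : List (Vec A m)) →
    length (filter P? (cartesianProductWith _∷_ (List.tabulate f) xs)) ≡
    ∑[ i < n ] length (filter (P? ∘ (f i ∷_)) xs)
  #filter-vectors {n = zero}  P? f xs = refl
  #filter-vectors {n = suc n} P? f xs = begin
    length (filter P? (here₀ List.++ rest))
      ≡⟨ cong length (filter-++ P? here₀ rest) ⟩
    length (filter P? here₀ List.++ filter P? rest)
      ≡⟨ length-++ (filter P? here₀) ⟩
    length (filter P? here₀) + length (filter P? rest)
      ≡⟨ cong₂ _+_ (#filter-map P? (f zero ∷_) xs) (#filter-vectors P? (f ∘ suc) xs) ⟩
    ∑[ i < suc n ] length (filter (P? ∘ (f i ∷_)) xs) ∎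
    where
    open ≡-Reasoning
    here₀ = List.map (f zero ∷_) xs
    rest  = cartesianProductWith _∷_ (List.tabulate (f ∘ suc)) xs

  module _ {R : Rel (Fin n) ℓ} (R? : Decidable R) where

    outdegree : Fin n → ℕ
    outdegree u = ∑[ v < n ] 𝟙 (R? u v)

    -- The number of chains u , v , w of R with first entry u.
    chainsFrom : Fin n → ℕ
    chainsFrom u = ∑[ v < n ] ∑[ w < n ] (𝟙 (R? u v) * (𝟙 (R? u w) * 𝟙 (R? v w)))

    #chains₃ : length (filter (allPairs? R?) (vectors (List.allFin n) 3)) ≡ sum chainsFrom
    #chains₃ =
      trans (#filter-vectors (allPairs? R?) id (vectors (List.allFin n) 2))
        (sum-cong-≗ λ u →
      trans (#filter-vectors (λ vs → allPairs? R? (u ∷ vs)) id (vectors (List.allFin n) 1))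
        (sum-cong-≗ λ v →
      trans (#filter-vectors (λ ws → allPairs? R? (u ∷ v ∷ ws)) id (vectors (List.allFin n) 0))
        (sum-cong-≗ λ w → triple u v w)))
      where
      triple : ∀ u v w →
        length (filter (λ xs → allPairs? R? (u ∷ v ∷ w ∷ xs)) ([] List.∷ List.[])) ≡
        𝟙 (R? u v) * (𝟙 (R? u w) * 𝟙 (R? v w))
      triple u v w with does (R? u v) | does (R? u w) | does (R? v w)
      ... | true  | true  | true  = refl
      ... | true  | true  | false = refl
      ... | true  | false | _     = refl
      ... | false | _     | _     = refl

    -- The hypothesis says that R is the arc relation of a tournament: exactly one
    -- of R u v, R v u and u ≡ v holds.
    module _ (tournament : ∀ u v → 𝟙 (R? u v) + 𝟙 (R? v u) + 𝟙 (u Fin.≟ v) ≡ 1) where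

      -- An ordered pair of out-neighbours of u is an arc, a reversed arc, or a
      -- repeated vertex.
      chainsFrom-outdegree : ∀ u → let d = outdegree u in chainsFrom u + chainsFrom u + d ≡ d * d
      chainsFrom-outdegree u = begin
        chainsFrom u + chainsFrom u + sum x
          ≡⟨ cong₂ (λ k l → chainsFrom u + k + l) (∑-comm arc) (sym diagonal) ⟩
        ∑[ v < n ] sum (arc v) + ∑[ v < n ] sum (reversed v) + ∑[ v < n ] sum (repeated v)
          ≡⟨ sum-+₃ (sum ∘ arc) (sum ∘ reversed) (sum ∘ repeated) ⟨
        ∑[ v < n ] (sum (arc v) + sum (reversed v) + sum (repeated v))
          ≡⟨ sum-cong-≗ (λ v → sum-+₃ (arc v) (reversed v) (repeated v)) ⟨
        ∑[ v < n ] ∑[ w < n ] (arc v w + reversed v w + repeated v w)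
          ≡⟨ sum-cong-≗ (λ v → sum-cong-≗ λ w → trans
               (factor (x v) (x w) (𝟙 (R? v w)) (𝟙 (R? w v)) (𝟙 (v Fin.≟ w)))
               (trans (cong (x v * x w *_) (tournament v w)) (ℕ.*-identityʳ (x v * x w)))) ⟩
        ∑[ v < n ] ∑[ w < n ] (x v * x w)
          ≡⟨ sum-cong-≗ (λ v → *-distribˡ-sum (x v) x) ⟨
        ∑[ v < n ] (x v * sum x)
          ≡⟨ *-distribʳ-sum (sum x) x ⟨
        sum x * sum x ∎
        where
        open ≡-Reasoning

        x : Fin n → ℕ
        x v = 𝟙 (R? u v)

        arc reversed repeated : Fin n → Fin n → ℕ
        arc      v w = x v * (x w * 𝟙 (R? v w))
        reversed v w = x w * (x v * 𝟙 (R? w v))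
        repeated v w = x v * (x w * 𝟙 (v Fin.≟ w))

        factor : ∀ a b r s t → a * (b * r) + b * (a * s) + a * (b * t) ≡ a * b * (r + s + t)
        factor = solve-∀

        sum-+₃ : (f g h : Fin n → ℕ) → ∑[ i < n ] (f i + g i + h i) ≡ sum f + sum g + sum h
        sum-+₃ f g h = trans (∑-distrib-+ (λ i → f i + g i) h) (cong (_+ sum h) (∑-distrib-+ f g))

        diagonal : ∑[ v < n ] sum (repeated v) ≡ sum x
        diagonal = sum-cong-≗ λ v → begin
          sum (repeated v)
            ≡⟨ *-distribˡ-sum (x v) (λ w → x w * 𝟙 (v Fin.≟ w)) ⟨
          x v * ∑[ w < n ] (x w * 𝟙 (v Fin.≟ w))
            ≡⟨ cong (x v *_) (sum-delta x v) ⟩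
          x v * x v
            ≡⟨ 𝟙-idem (R? u v) ⟩
          x v ∎

-- Finite sums and parity

odd≢even : ∀ a b → suc (a ℕ.+ a) ≢ b ℕ.+ b
odd≢even zero    (suc (suc b)) ()
odd≢even zero    (suc zero)    ()
odd≢even (suc a) (suc b) eq =
  odd≢even a b (ℕ.suc-injective (ℕ.suc-injective (≡.trans
    (cong (2 ℕ.+_) (≡.sym (ℕ.+-suc a a)))
    (≡.trans eq (cong suc (ℕ.+-suc b b))))))

double-injective : ∀ {a b} → a ℕ.+ a ≡ b ℕ.+ b → a ≡ b
double-injective {a} {b} eq = ℕ.*-cancelˡ-≡ a b 2
  (≡.trans (cong (a ℕ.+_) (ℕ.+-identityʳ a)) (≡.trans eq (cong (b ℕ.+_) (≡.sym (ℕ.+-identityʳ b)))))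

module FiniteSum (S : Setoid c ℓ) {q : ℕ} (enum : Enumeration S q) where
  open Setoid S
  open Inverse enum

  -- The sum of a function over a finite setoid. It is meaningful for functions
  -- respecting the setoid equality; this is required only where it is used.
  total : (Carrier → ℕ) → ℕ
  total g = ∑[ i < q ] g (from i)

  total-cong : {g h : Carrier → ℕ} → (∀ x → g x ≡ h x) → total g ≡ total h
  total-cong g≗h = sum-cong-≗ (g≗h ∘ from)

  -- Invariance of the sum under a bijection φ with inverse ψ.
  total-reindex : (φ ψ : Carrier → Carrier) →
    (∀ {x y} → x ≈ y → φ x ≈ φ y) → (∀ {x y} → x ≈ y → ψ x ≈ ψ y) →
    (∀ x → φ (ψ x) ≈ x) → (∀ x → ψ (φ x) ≈ x) →
    {g : Carrier → ℕ} → (∀ {x y} → x ≈ y → g x ≡ g y) → total g ≡ total (g ∘ φ)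
  total-reindex φ ψ φ-cong ψ-cong φψ ψφ {g} g-cong = ≡.trans
    (sum-permute (g ∘ from) (permutation (to ∘ φ ∘ from) (to ∘ ψ ∘ from)
      (λ i → ≡.trans (to-cong (trans (φ-cong (strictlyInverseʳ _)) (φψ _))) (strictlyInverseˡ i))
      (λ i → ≡.trans (to-cong (trans (ψ-cong (strictlyInverseʳ _)) (ψφ _))) (strictlyInverseˡ i))))
    (sum-cong-≗ λ i → g-cong (strictlyInverseʳ (φ (from i))))

  to-injective : ∀ {x y} → to x ≡ to y → x ≈ y
  to-injective eq = trans (sym (strictlyInverseʳ _)) (inverseʳ eq)

  -- A set stable under an involution without fixed points in it has even
  -- cardinality: count the elements that precede their image.
  even-cardinality : (φ : Carrier → Carrier) →
    (∀ {x y} → x ≈ y → φ x ≈ φ y) → (∀ x → φ (φ x) ≈ x) →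
    {P : Pred Carrier p} (P? : Unary.Decidable P) → (∀ {x y} → x ≈ y → P x → P y) →
    (∀ {x} → P x → P (φ x)) → (∀ {x} → P x → ¬ x ≈ φ x) →
    ∃[ h ] total (𝟙 ∘ P?) ≡ h ℕ.+ h
  even-cardinality φ φ-cong φφ {P} P? P-resp P-stable no-fixed = total half , (begin
    total (𝟙 ∘ P?)                        ≡⟨ total-cong split ⟩
    total (λ x → half x ℕ.+ half (φ x))   ≡⟨ ∑-distrib-+ (half ∘ from) (half ∘ φ ∘ from) ⟩
    total half ℕ.+ total (half ∘ φ)       ≡⟨ cong (total half ℕ.+_)
      (total-reindex φ φ φ-cong φ-cong φφ φφ half-cong) ⟨
    total half ℕ.+ total half             ∎)
    where
    open ≡-Reasoning

    Half? : ∀ x → Dec (P x × to x Fin.< to (φ x))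
    Half? x = P? x ×-dec (to x Fin.<? to (φ x))

    half : Carrier → ℕ
    half = 𝟙 ∘ Half?

    half-resp : ∀ {x y} → x ≈ y → P x × to x Fin.< to (φ x) → P y × to y Fin.< to (φ y)
    half-resp x≈y (px , x<φx) =
      P-resp x≈y px , ≡.subst₂ Fin._<_ (to-cong x≈y) (to-cong (φ-cong x≈y)) x<φx

    half-cong : ∀ {x y} → x ≈ y → half x ≡ half y
    half-cong x≈y = 𝟙-cong (Half? _) (Half? _) (half-resp x≈y) (half-resp (sym x≈y))

    split : ∀ x → 𝟙 (P? x) ≡ half x ℕ.+ half (φ x)
    split x with P? x
    ... | no ¬px = ≡.sym (𝟙-false (Half? (φ x)) λ (pφx , _) → ¬px (P-resp (φφ x) (P-stable pφx)))
    ... | yes px with Fin.<-cmp (to x) (to (φ x))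
    ...   | tri< x<φx _ φx≮x = ≡.sym (cong₂ ℕ._+_ (𝟙-true (to x Fin.<? to (φ x)) x<φx)
              (𝟙-false (Half? (φ x)) λ (_ , lt) → φx≮x (≡.subst (to (φ x) Fin.<_) (to-cong (φφ x)) lt)))
    ...   | tri≈ _ x≡φx _ = contradiction (to-injective x≡φx) (no-fixed px)
    ...   | tri> x≮φx _ φx<x = ≡.sym (cong₂ ℕ._+_ (𝟙-false (to x Fin.<? to (φ x)) x≮φx)
              (𝟙-true (Half? (φ x)) (P-stable px , ≡.subst (to (φ x) Fin.<_) (≡.sym (to-cong (φφ x))) φx<x)))

-- Squares in a finite field of order 3 modulo 4

module FiniteField (F : HeytingField c ℓ₁ ℓ₂) {q : ℕ}
                   (enum : Enumeration (HeytingField.setoid F) q) where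
  open HeytingField F
  open CommutativeRing (HeytingCommutativeRing.commutativeRing heytingCommutativeRing)
    using (ring; *-commutativeSemigroup)
  open HeytingProperties heytingCommutativeRing using (1#0; x-0≈x)
  open RingProperties ring
  open Inverse enum
  open FiniteSum setoid enum
  open SetoidReasoning setoid
  open CommutativeSemigroupProperties *-commutativeSemigroup using () renaming (interchange to *-interchange)

  -- The two decision procedures below are opaque so that case analysis on them
  -- is visible in indicators; their values never matter beyond being decisions.
  infix 4 _≟F_
  opaque
    _≟F_ : ∀ x y → Dec (x ≈ y)
    _≟F_ = _≈?_ F enum

  IsNonzero : Carrier → Set _
  IsNonzero x = ¬ (x ≈ 0#)

  -- The set of nonzero squares.
  S : Carrier → Set _
  S = IsNonzeroSquare F enum

  opaque
    S? : ∀ x → Dec (S x)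
    S? = isNonzeroSquare? F enum

  S-resp : ∀ {x y} → x ≈ y → S x → S y
  S-resp = isNonzeroSquare-resp F enum

  #squares : ℕ
  #squares = total (𝟙 ∘ S?)

  1≉0 : IsNonzero 1#
  1≉0 1≈0 = #-irrefl 1≈0 1#0

  -- Tightness of the apartness relation makes a nonzero element not fail to be
  -- invertible, which suffices below: every conclusion drawn from it is absurdity
  -- or a decidable equality.
  ≉0⇒¬¬unit : ∀ {x} → IsNonzero x → ¬ ¬ (∃[ y ] y * x ≈ 1#)
  ≉0⇒¬¬unit {x} x≉0 ¬unit = x≉0 (proj₁ (tight x 0#) λ x#0 →
    let y , y[x-0]≈1 , _ = #⇒invertible x#0
    in ¬unit (y , trans (*-congˡ (sym (x-0≈x x))) y[x-0]≈1))

  cancel-≉0 : ∀ {x y} → IsNonzero x → x * y ≈ 0# → y ≈ 0#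
  cancel-≉0 {x} {y} x≉0 xy≈0 with y ≟F 0#
  ... | yes y≈0 = y≈0
  ... | no  y≉0 = contradiction (λ (u , ux≈1) → y≉0 (begin
    y           ≈⟨ *-identityˡ y ⟨
    1# * y      ≈⟨ *-congʳ ux≈1 ⟨
    u * x * y   ≈⟨ *-assoc u x y ⟩
    u * (x * y) ≈⟨ *-congˡ xy≈0 ⟩
    u * 0#      ≈⟨ zeroʳ u ⟩
    0#          ∎)) (≉0⇒¬¬unit x≉0)

  -‿≉0 : ∀ {x} → IsNonzero x → IsNonzero (- x)
  -‿≉0 x≉0 -x≈0 = x≉0 (trans (sym (-‿involutive _)) (trans (-‿cong -x≈0) -0#≈0#))

  square-neg : ∀ x → - x * - x ≈ x * x
  square-neg x = begin
    - x * - x     ≈⟨ -‿distribˡ-* x (- x) ⟨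
    - (x * - x)   ≈⟨ -‿cong (-‿distribʳ-* x x) ⟨
    - - (x * x)   ≈⟨ -‿involutive (x * x) ⟩
    x * x         ∎

  -- From x² = z² follows (x - z)(x + z) = 0.
  square≈⇒≈± : ∀ {x z} → x * x ≈ z * z → ¬ z ≈ x → - z ≈ x
  square≈⇒≈± {x} {z} xx≈zz z≉x = sym (+-inverseˡ-unique x z (cancel-≉0 x-z≉0 (begin
    (x - z) * (x + z)           ≈⟨ [y-z]x≈yx-zx (x + z) x z ⟩
    x * (x + z) - z * (x + z)   ≈⟨ +-cong (distribˡ x x z) (-‿cong (distribˡ z x z)) ⟩
    (x * x + x * z) - (z * x + z * z)
      ≈⟨ +-congˡ (-‿cong (trans (+-cong (*-comm z x) (sym xx≈zz)) (+-comm (x * z) (x * x)))) ⟩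
    (x * x + x * z) - (x * x + x * z)
      ≈⟨ -‿inverseʳ _ ⟩
    0# ∎)))
    where
    x-z≉0 : IsNonzero (x - z)
    x-z≉0 x-z≈0 = z≉x (sym (x∙y⁻¹≈ε⇒x≈y x z x-z≈0))

  square≈0⇒≈0 : ∀ {x} → x * x ≈ 0# → x ≈ 0#
  square≈0⇒≈0 {x} xx≈0 with x ≟F 0#
  ... | yes x≈0 = x≈0
  ... | no  x≉0 = cancel-≉0 x≉0 xx≈0

  S-mul : ∀ {x y} → S x → S y → S (x * y)
  S-mul {x} {y} (x≉0 , a , x≈aa) (y≉0 , b , y≈bb) =
    y≉0 ∘ cancel-≉0 x≉0 , a * b , trans (*-cong x≈aa y≈bb) (*-interchange a a b b)

  total-𝟙≈ : ∀ x → total (λ y → 𝟙 (x ≟F y)) ≡ 1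
  total-𝟙≈ x = ≡.trans (sum-cong-≗ λ i → ≡.trans
    (𝟙-cong (x ≟F from i) (to x Fin.≟ i) (λ eq → ≡.trans (to-cong eq) (strictlyInverseˡ i))
      (λ eq → sym (inverseʳ (≡.sym eq))))
    (≡.sym (ℕ.*-identityˡ _)))
    (sum-delta (λ _ → 1) (to x))

  #nonzero : total (λ x → 𝟙 (¬? (x ≟F 0#))) ℕ.+ 1 ≡ q
  #nonzero = R.begin
    total (λ x → 𝟙 (¬? (x ≟F 0#))) ℕ.+ 1
      R.≡⟨ cong (total (λ x → 𝟙 (¬? (x ≟F 0#))) ℕ.+_) (total-𝟙≈ 0#) ⟨
    total (λ x → 𝟙 (¬? (x ≟F 0#))) ℕ.+ total (λ x → 𝟙 (0# ≟F x))
      R.≡⟨ ∑-distrib-+ (λ i → 𝟙 (¬? (from i ≟F 0#))) (λ i → 𝟙 (0# ≟F from i)) ⟨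
    total (λ x → 𝟙 (¬? (x ≟F 0#)) ℕ.+ 𝟙 (0# ≟F x))
      R.≡⟨ total-cong one ⟩
    total (λ _ → 1)
      R.≡⟨ sum-ones q ⟩
    q R.∎
    where
    module R = ≡-Reasoning
    one : ∀ x → 𝟙 (¬? (x ≟F 0#)) ℕ.+ 𝟙 (0# ≟F x) ≡ 1
    one x = ≡.trans
      (cong (𝟙 (¬? (x ≟F 0#)) ℕ.+_) (𝟙-cong (0# ≟F x) (x ≟F 0#) sym sym))
      (𝟙-¬ (x ≟F 0#))

  -- Fields with 1 + 2k elements.
  module OddOrder {k : ℕ} (q≡1+2k : q ≡ suc (k ℕ.+ k)) where

    -- If 1 + 1 vanished, adding 1 would pair off the elements of the field.
    2≉0 : IsNonzero (1# + 1#)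
    2≉0 2≈0 with h , eq ← even-cardinality (_+ 1#) +-congʳ
                (λ x → trans (+-assoc x 1# 1#) (trans (+-congˡ 2≈0) (+-identityʳ x)))
                (λ _ → yes tt) (λ _ _ → tt) (λ _ → tt)
                (λ {x} _ x≈x+1 → 1≉0 (+-identityʳ-unique x 1# (sym x≈x+1)))
      = odd≢even k h (≡.trans (≡.sym q≡1+2k) (≡.trans (≡.sym (sum-ones q)) eq))

    x≉-x : ∀ {x} → IsNonzero x → ¬ x ≈ - x
    x≉-x {x} x≉0 x≈-x = x≉0 (cancel-≉0 2≉0 (begin
      (1# + 1#) * x    ≈⟨ distribʳ x 1# 1# ⟩
      1# * x + 1# * x  ≈⟨ +-cong (*-identityˡ x) (trans (*-identityˡ x) x≈-x) ⟩
      x - x            ≈⟨ -‿inverseʳ x ⟩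
      0#               ∎))

    private
      -- Whether x is a nonzero square root of y.
      Root? : ∀ y x → Dec (IsNonzero x × x * x ≈ y)
      Root? y x = ¬? (x ≟F 0#) ×-dec (x * x ≟F y)

    -- The square roots of a nonzero square are z and - z for one root z.
    #roots : ∀ y → total (λ x → 𝟙 (Root? y x)) ≡ 𝟙 (S? y) ℕ.+ 𝟙 (S? y)
    #roots y with S? y
    ... | no ¬sy = ≡.trans
      (total-cong λ x → 𝟙-false (Root? y x) λ (x≉0 , xx≈y) →
        ¬sy ((λ y≈0 → x≉0 (square≈0⇒≈0 (trans xx≈y y≈0))) , x , sym xx≈y))
      (sum-replicate-zero q)
    ... | yes (y≉0 , z , y≈zz) = ≡.trans (total-cong ±z) (≡.trans
      (∑-distrib-+ (λ i → 𝟙 (z ≟F from i)) (λ i → 𝟙 (- z ≟F from i)))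
      (cong₂ ℕ._+_ (total-𝟙≈ z) (total-𝟙≈ (- z))))
      where
      z≉0 : IsNonzero z
      z≉0 z≈0 = y≉0 (trans y≈zz (trans (*-congˡ z≈0) (zeroʳ z)))

      ±z : ∀ x → 𝟙 (Root? y x) ≡ 𝟙 (z ≟F x) ℕ.+ 𝟙 (- z ≟F x)
      ±z x with z ≟F x | - z ≟F x
      ... | yes z≈x | yes -z≈x = contradiction (trans z≈x (sym -z≈x)) (x≉-x z≉0)
      ... | yes z≈x | no  -z≉x = 𝟙-true (Root? y x)
        ((λ x≈0 → z≉0 (trans z≈x x≈0)) , trans (*-cong (sym z≈x) (sym z≈x)) (sym y≈zz))
      ... | no  z≉x | yes -z≈x = 𝟙-true (Root? y x)
        ((λ x≈0 → -‿≉0 z≉0 (trans -z≈x x≈0)) ,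
         trans (*-cong (sym -z≈x) (sym -z≈x)) (trans (square-neg z) (sym y≈zz)))
      ... | no  z≉x | no  -z≉x = 𝟙-false (Root? y x) λ (x≉0 , xx≈y) →
        -z≉x (square≈⇒≈± (trans xx≈y y≈zz) z≉x)

    -- Count the nonzero elements of the field by their squares.
    #nonzero≡2#squares : total (λ x → 𝟙 (¬? (x ≟F 0#))) ≡ #squares ℕ.+ #squares
    #nonzero≡2#squares = R.begin
      total (λ x → 𝟙 (¬? (x ≟F 0#)))
        R.≡⟨ total-cong by-square ⟩
      total (λ x → total (λ y → 𝟙 (Root? y x)))
        R.≡⟨ ∑-comm (λ i j → 𝟙 (Root? (from j) (from i))) ⟩
      total (λ y → total (λ x → 𝟙 (Root? y x)))
        R.≡⟨ total-cong #roots ⟩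
      total (λ y → 𝟙 (S? y) ℕ.+ 𝟙 (S? y))
        R.≡⟨ ∑-distrib-+ (𝟙 ∘ S? ∘ from) (𝟙 ∘ S? ∘ from) ⟩
      #squares ℕ.+ #squares R.∎
      where
      module R = ≡-Reasoning
      by-square : ∀ x → 𝟙 (¬? (x ≟F 0#)) ≡ total (λ y → 𝟙 (Root? y x))
      by-square x with x ≟F 0#
      ... | yes _ = ≡.sym (sum-replicate-zero q)
      ... | no  _ = ≡.sym (total-𝟙≈ (x * x))

    #squares≡k : #squares ≡ k
    #squares≡k = double-injective (ℕ.+-cancelʳ-≡ 1 _ _ (≡.trans
      (cong (ℕ._+ 1) (≡.sym #nonzero≡2#squares))
      (≡.trans #nonzero (≡.trans q≡1+2k (ℕ.+-comm 1 (k ℕ.+ k))))))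

    -- Fields with 3 + 4j elements.
    module ThreeModFour {j : ℕ} (k≡1+2j : k ≡ suc (j ℕ.+ j)) where

      -- Otherwise negation would pair off the nonzero squares, which are odd
      -- in number.
      -1∉S : ¬ S (- 1#)
      -1∉S s with h , eq ← even-cardinality -_ -‿cong -‿involutive S? S-resp
                  (λ {x} sx → S-resp (-1*x≈-x x) (S-mul s sx)) (x≉-x ∘ proj₁)
        = odd≢even j h (≡.trans (≡.sym k≡1+2j) (≡.trans (≡.sym #squares≡k) eq))

      -- If x = a² and - x = b² then - 1 = (a⁻¹ b)².
      S-antisym : ∀ {x} → S x → ¬ S (- x)
      S-antisym {x} (x≉0 , a , x≈aa) (_ , b , -x≈bb) = ≉0⇒¬¬unit a≉0 λ (u , ua≈1) →
        -1∉S (-‿≉0 1≉0 , u * b , (begin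
          - 1#                  ≈⟨ -‿cong (trans (*-cong ua≈1 ua≈1) (*-identityˡ 1#)) ⟨
          - (u * a * (u * a))   ≈⟨ -‿cong (*-interchange u a u a) ⟩
          - (u * u * (a * a))   ≈⟨ -‿cong (*-congˡ x≈aa) ⟨
          - (u * u * x)         ≈⟨ -‿distribʳ-* (u * u) x ⟩
          u * u * - x           ≈⟨ *-congˡ -x≈bb ⟩
          u * u * (b * b)       ≈⟨ *-interchange u u b b ⟩
          u * b * (u * b)       ∎))
        where
        a≉0 : IsNonzero a
        a≉0 a≈0 = x≉0 (trans x≈aa (trans (*-congˡ a≈0) (zeroʳ a)))

      -- The nonzero squares and their negatives are disjoint and together as many as
      -- the nonzero elements, hence exhaust them.
      S-or-neg : ∀ x → 𝟙 (S? x) ℕ.+ 𝟙 (S? (- x)) ≡ 𝟙 (¬? (x ≟F 0#))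
      S-or-neg x = ≡.trans (≡.sym (f-cong (strictlyInverseʳ x))) (≡.trans
        (sum-≤-≡ (f ∘ from) (g ∘ from) (f≤g ∘ from) totals (to x))
        (𝟙-cong (¬? (_ ≟F 0#)) (¬? (x ≟F 0#))
          (λ ≉0 x≈0 → ≉0 (trans (strictlyInverseʳ x) x≈0))
          (λ ≉0 x≈0 → ≉0 (trans (sym (strictlyInverseʳ x)) x≈0))))
        where
        f g : Carrier → ℕ
        f x = 𝟙 (S? x) ℕ.+ 𝟙 (S? (- x))
        g x = 𝟙 (¬? (x ≟F 0#))

        S-cong : ∀ {x y} → x ≈ y → 𝟙 (S? x) ≡ 𝟙 (S? y)
        S-cong x≈y = 𝟙-cong (S? _) (S? _) (S-resp x≈y) (S-resp (sym x≈y))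

        f-cong : ∀ {x y} → x ≈ y → f x ≡ f y
        f-cong x≈y = cong₂ ℕ._+_ (S-cong x≈y) (S-cong (-‿cong x≈y))

        f≤g : ∀ x → f x ≤ g x
        f≤g x with S? x | S? (- x)
        ... | yes sx | yes s-x = contradiction s-x (S-antisym sx)
        ... | yes sx | no  _   = ℕ.≤-reflexive (≡.sym (𝟙-true (¬? (x ≟F 0#)) (proj₁ sx)))
        ... | no  _  | yes s-x = ℕ.≤-reflexive (≡.sym (𝟙-true (¬? (x ≟F 0#))
          (λ x≈0 → proj₁ s-x (trans (-‿cong x≈0) -0#≈0#))))
        ... | no  _  | no  _   = z≤n

        totals : total f ≡ total g
        totals = ≡.trans (∑-distrib-+ (𝟙 ∘ S? ∘ from) (𝟙 ∘ S? ∘ -_ ∘ from)) (≡.trans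
          (cong (#squares ℕ.+_)
            (≡.sym (total-reindex -_ -_ -‿cong -‿cong -‿involutive -‿involutive S-cong)))
          (≡.sym #nonzero≡2#squares))

      private
        -- The Paley tournament.
        G : FiniteDigraph _ _ _
        G = G₂ F enum

      ⇒-asym : Asymmetric (_⇒_ G)
      ⇒-asym {u} {v} u⇒v v⇒u =
        S-antisym u⇒v (S-resp (sym (⁻¹-anti-homo‿- (from v) (from u))) v⇒u)

      ⇒-tournament : ∀ u v →
        𝟙 (_⇒?_ G u v) ℕ.+ 𝟙 (_⇒?_ G v u) ℕ.+ 𝟙 (u Fin.≟ v) ≡ 1
      ⇒-tournament u v = R.begin
        𝟙 (_⇒?_ G u v) ℕ.+ 𝟙 (_⇒?_ G v u) ℕ.+ 𝟙 (u Fin.≟ v)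
          R.≡⟨ cong₂ ℕ._+_ (cong₂ ℕ._+_
                 (𝟙-cong (_⇒?_ G u v) (S? d) id id)
                 (𝟙-cong (_⇒?_ G v u) (S? (- d)) (S-resp (sym -d)) (S-resp -d)))
               (𝟙-cong (u Fin.≟ v) (d ≟F 0#)
                 (λ { ≡.refl → -‿inverseʳ (from u) })
                 (λ d≈0 → ≡.trans (≡.sym (strictlyInverseˡ u))
                   (inverseˡ (sym (x∙y⁻¹≈ε⇒x≈y (from v) (from u) d≈0))))) ⟩
        𝟙 (S? d) ℕ.+ 𝟙 (S? (- d)) ℕ.+ 𝟙 (d ≟F 0#)
          R.≡⟨ cong (ℕ._+ 𝟙 (d ≟F 0#)) (S-or-neg d) ⟩
        𝟙 (¬? (d ≟F 0#)) ℕ.+ 𝟙 (d ≟F 0#)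
          R.≡⟨ 𝟙-¬ (d ≟F 0#) ⟩
        1 R.∎
        where
        module R = ≡-Reasoning

        d : Carrier
        d = from v - from u

        -d : - d ≈ from u - from v
        -d = ⁻¹-anti-homo‿- (from v) (from u)

      -- The out-neighbours of a vertex are its translates by nonzero squares.
      ⇒-outdegree : ∀ u → outdegree (_⇒?_ G) u ≡ k
      ⇒-outdegree u = ≡.trans
        (sum-cong-≗ λ v → 𝟙-cong (_⇒?_ G u v) (S? (from v - from u)) id id)
        (≡.trans (≡.sym (total-reindex (_- from u) (_+ from u) +-congʳ +-congʳ
            (//-rightDividesʳ (from u)) (//-rightDividesˡ (from u))
            (λ x≈y → 𝟙-cong (S? _) (S? _) (S-resp x≈y) (S-resp (sym x≈y)))))
          #squares≡k)

      -- Solve t + t + k = k² for t, with k = 1 + 2j.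
      chainsFrom≡kj : ∀ u → chainsFrom (_⇒?_ G) u ≡ k ℕ.* j
      chainsFrom≡kj u = double-injective (ℕ.+-cancelʳ-≡ k _ _ (R.begin
        t ℕ.+ t ℕ.+ k
          R.≡⟨ ≡.subst (λ d → t ℕ.+ t ℕ.+ d ≡ d ℕ.* d) (⇒-outdegree u)
                 (chainsFrom-outdegree (_⇒?_ G) ⇒-tournament u) ⟩
        k ℕ.* k
          R.≡⟨ cong (k ℕ.*_) k≡1+2j ⟩
        k ℕ.* suc (j ℕ.+ j)
          R.≡⟨ expand k j ⟩
        k ℕ.* j ℕ.+ k ℕ.* j ℕ.+ k R.∎))
        where
        module R = ≡-Reasoning

        t : ℕ
        t = chainsFrom (_⇒?_ G) u

        expand : ∀ k j → k ℕ.* suc (j ℕ.+ j) ≡ k ℕ.* j ℕ.+ k ℕ.* j ℕ.+ k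
        expand = solve-∀

      𝒦₃-Paley : 𝒦 3 G ≡ q ℕ.* (k ℕ.* j)
      𝒦₃-Paley = ≡.trans (𝒦≡#chains G ⇒-asym 3) (≡.trans (#chains₃ (_⇒?_ G))
        (≡.trans (sum-cong-≗ chainsFrom≡kj) (sum-const q (k ℕ.* j))))

-- The closed form

open import Data.Integer.Base using (+_; _-_; _*_)
import Data.Integer.Properties as ℤ
open import Data.Rational.Base using (_/_)
import Data.Rational.Properties as ℚ
open import Data.Rational.Unnormalised.Base using (mkℚᵘ; *≡*)

-- For q = 3 + 4j the integer subtractions compute: q - 1 is 2 + 4j and q - 3 is
-- 4j, both by definition.
count-formula : ∀ {q} j → q ≡ 3 ℕ.+ j ℕ.* 4 →
  + (q ℕ.* (suc (j ℕ.+ j) ℕ.* j)) * + 8 ≡ (+ q * (+ q - + 1) * (+ q - + 3)) * + 1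
count-formula j ≡.refl = begin
  + (q ℕ.* (suc (j ℕ.+ j) ℕ.* j)) * + 8
    ≡⟨ ℤ.pos-* (q ℕ.* (suc (j ℕ.+ j) ℕ.* j)) 8 ⟨
  + (q ℕ.* (suc (j ℕ.+ j) ℕ.* j) ℕ.* 8)
    ≡⟨ cong +_ (polynomial j) ⟩
  + (q ℕ.* (2 ℕ.+ j ℕ.* 4) ℕ.* (j ℕ.* 4))
    ≡⟨ ℤ.pos-* (q ℕ.* (2 ℕ.+ j ℕ.* 4)) (j ℕ.* 4) ⟩
  + (q ℕ.* (2 ℕ.+ j ℕ.* 4)) * + (j ℕ.* 4)
    ≡⟨ cong (_* + (j ℕ.* 4)) (ℤ.pos-* q (2 ℕ.+ j ℕ.* 4)) ⟩
  + q * + (2 ℕ.+ j ℕ.* 4) * + (j ℕ.* 4)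
    ≡⟨ ℤ.*-identityʳ _ ⟨
  + q * + (2 ℕ.+ j ℕ.* 4) * + (j ℕ.* 4) * + 1 ∎
  where
  open ≡-Reasoning

  q : ℕ
  q = 3 ℕ.+ j ℕ.* 4

  polynomial : ∀ j → (3 ℕ.+ j ℕ.* 4) ℕ.* (suc (j ℕ.+ j) ℕ.* j) ℕ.* 8 ≡
                     (3 ℕ.+ j ℕ.* 4) ℕ.* (2 ℕ.+ j ℕ.* 4) ℕ.* (j ℕ.* 4)
  polynomial = solve-∀

corollary2p7 : ∀ {c ℓ₁ ℓ₂} (q : ℕ) → IsPrimePower q → q % 4 ≡ 3 →
    (𝔽q : HeytingField c ℓ₁ ℓ₂) (enum : Enumeration (HeytingField.setoid 𝔽q) q) →
    + 𝒦 3 (G₂ 𝔽q enum) / 1 ≡ (+ q * (+ q - + 1) * (+ q - + 3)) / (2 ^ 3)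
-- Both fractions are images of unnormalised ones with denominators 1 and 8, whose
-- equality is the cross-multiplied identity over the integers.
corollary2p7 q _ q%4≡3 𝔽q enum = ℚ.fromℚᵘ-cong
  {mkℚᵘ (+ 𝒦 3 (G₂ 𝔽q enum)) 0} {mkℚᵘ (+ q * (+ q - + 1) * (+ q - + 3)) 7}
  (*≡* (≡.trans (cong (λ K → + K * + 8) 𝒦₃-Paley) (count-formula j q≡3+4j)))
  where
  j : ℕ
  j = q ℕ./ 4

  q≡3+4j : q ≡ 3 ℕ.+ j ℕ.* 4
  q≡3+4j = ≡.trans (m≡m%n+[m/n]*n q 4) (cong (ℕ._+ j ℕ.* 4) q%4≡3)

  double : ∀ j → 3 ℕ.+ j ℕ.* 4 ≡ suc (suc (j ℕ.+ j) ℕ.+ suc (j ℕ.+ j))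
  double = solve-∀

  open FiniteField 𝔽q enum
  open OddOrder {k = suc (j ℕ.+ j)} (≡.trans q≡3+4j (double j))
  open ThreeModFour {j = j} ≡.refl
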